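{- Let $Q=(q_1,\ldots,q_k)$ be an instance of the FIFO stack-up problem, let $n$ be the total number of bins in $Q$, and let $(Q,Q_0),(Q,Q_1),\ldots,(Q,Q_n)$ with $Q_0=Q$ and $Q_n=(\emptyset,\ldots,\emptyset)$ be a processing of $Q$ with $p$ stack-up places (i.e. $|\mathit{open}(Q,Q_i)|\le p$ for all $0\le i\le n$). Then the sequence $\mathcal{X}=(\mathit{open}(Q,Q_0),\ldots,\mathit{open}(Q,Q_n))$ is a directed path-decomposition of the sequence graph $G_Q$ of width at most $p-1$.
   Context: A bin $b$ carries a pallet symbol $\mathit{plt}(b)$ (a positive integer); bin $b$ is destined for pallet $\mathit{plt}(b)$. An instance is a list $Q=(q_1,\ldots,q_k)$ of finite sequences of bins, all bins (across all sequences) pairwise distinct; it is assumed that for every pallet symbol occurring, the sequences together contain at least two bins destined for it. $\mathit{plts}(Q)$ is the set of pallet symbols of all bins in $Q$. A subsequence of $q=(b_1,\ldots,b_n)$ is a suffix $q'=(b_j,\ldots,b_n)$, $j\ge 1$ (possibly empty), and $q-q'=(b_1,\ldots,b_{j-1})$. A configuration is a pair $(Q,Q')$ with $Q'=(q'_1,\ldots,q'_k)$, each $q'_j$ a subsequence of $q_j$. A pallet $t$ is open in $(Q,Q')$ if some bin destined for $t$ lies in some $q'_i$ and some bin destined for $t$ lies in some $q_j-q'_j$; $\mathit{open}(Q,Q')$ denotes the set of open pallets. A transformation step removes the first bin of one nonempty $q'_i$. A processing of $Q$ is a sequence of configurations $(Q,Q_0),\ldots,(Q,Q_n)$ with $Q_0=Q$,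 $Q_n$ consisting of $k$ empty sequences, each obtained from the previous by one transformation step; it uses $p$ stack-up places if every configuration has at most $p$ open pallets. The sequence graph $G_Q=(V,E)$ has $V=\mathit{plts}(Q)$ and an arc $(u,v)$ iff $u\ne v$ and some sequence $q_i$ contains a bin destined for $u$ at a position strictly before a bin destined for $v$. A directed path-decomposition of a digraph $G=(V,E)$ is a sequence $(X_1,\ldots,X_r)$ of subsets of $V$ with: (1) $X_1\cup\cdots\cup X_r=V$; (2) for every arc $(u,v)\in E$ there are $i\le j$ with $u\in X_i$, $v\in X_j$; (3) if $u\in X_i$ and $u\in X_j$ with $i\le j$ then $u\in X_l$ for all $i\le l\le j$. Its width is $\max_i |X_i|-1$. -}

module Defs where

open import Data.Fin using (Fin; zero; suc; inject₁; fromℕ)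
import Data.Fin as Fin
import Data.Fin.Properties as Fin
open import Data.Integer using (ℤ; +_; 1ℤ; _-_)
open import Data.List
  using (List; []; _∷_; length; map; concat; take; filter; deduplicate)
import Data.List as List
import Data.List.Membership.Propositional as List
open import Data.List.Membership.Propositional.Properties
  using (∈-lookup; ∈-map⁺; ∈-concat⁺′; ∈-deduplicate⁺)
open import Data.List.Relation.Binary.Suffix.Heterogeneous using (Suffix)
open import Data.List.Relation.Unary.Any using (Any; any?)
open import Data.List.Relation.Unary.Unique.Propositional using (Unique)
open import Data.List.Relation.Unary.Unique.Propositional.Properties using (filter⁺)
open import Data.List.Relation.Unary.Unique.DecPropositional.Properties
  using (deduplicate-!)
open import Data.Nat using (ℕ; suc; _∸_; _⊔_; _≤_; _≟_; NonZero)
open import Data.Product using (∃₂; ∃-syntax; _×_; _,_)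
open import Data.Vec using (Vec; lookup; toList; replicate; _[_]≔_)
open import Data.Vec.Functional using (Vector; foldr)
open import Data.Vec.Membership.Propositional.Properties
  using (∈-toList⁺) renaming (∈-lookup to ∈-lookup-Vec)
open import Function.Bundles using (_⇔_)
open import Relation.Binary.PropositionalEquality using (_≡_; _≢_; refl)
open import Relation.Nullary using (Dec; _×-dec_)

record FinSet (A : Set) : Set where
  field
    elements : List A
    unique   : Unique elements

infix 4 _∈_

_∈_ : {A : Set} → A → FinSet A → Set
x ∈ X = x List.∈ FinSet.elements X

∣_∣ : {A : Set} → FinSet A → ℕ
∣ X ∣ = length (FinSet.elements X)

record Digraph (A : Set) : Set₁ where
  field
    vertices : FinSet A
    Arc      : A → A → Set
    Arc⊆V×V  : ∀ {u v} → Arc u v → u ∈ vertices × v ∈ vertices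

record IsDirectedPathDecomposition
  {A : Set} (G : Digraph A) {r : ℕ} (X : Vector (FinSet A) r) : Set where
  open Digraph G
  field
    union    : ∀ {v} → (∃[ i ] v ∈ X i) ⇔ v ∈ vertices
    arcs     : ∀ {u v} → Arc u v → ∃₂ λ i j → i Fin.≤ j × u ∈ X i × v ∈ X j
    interval : ∀ {u i j} → i Fin.≤ j → u ∈ X i → u ∈ X j →
               ∀ l → i Fin.≤ l → l Fin.≤ j → u ∈ X l

-- Integer-valued, since the width is -1 when all bags are empty.
width : {A : Set} {r : ℕ} → Vector (FinSet A) r → ℤ
width X = + foldr _⊔_ 0 (λ i → ∣ X i ∣) - 1ℤ

record Instance : Set₁ where
  field
    Bin          : Set
    plt          : Bin → ℕ
    plt-positive : ∀ b → NonZero (plt b)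
    k            : ℕ
    Q            : Vec (List Bin) k

  bins : List Bin
  bins = concat (toList Q)

  field
    distinct : Unique bins
    twoBins  : ∀ {t} → t List.∈ map plt bins →
               2 ≤ length (filter (λ b → plt b ≟ t) bins)

  plts : FinSet ℕ
  plts = record
    { elements = deduplicate _≟_ (map plt bins)
    ; unique   = deduplicate-! _≟_ (map plt bins)
    }

module _ (I : Instance) where
  open Instance I

  record Configuration : Set where
    field
      Q′     : Vec (List Bin) k
      suffix : ∀ i → Suffix _≡_ (lookup Q′ i) (lookup Q i)

    -- The prefix q - q′ that remains when the suffix q′ is cut off from q.
    removed : Fin k → List Bin
    removed i = take (length (lookup Q i) ∸ length (lookup Q′ i)) (lookup Q i)

    Open : ℕ → Set
    Open t = (∃[ i ] Any (λ b → plt b ≡ t) (lookup Q′ i))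
           × (∃[ j ] Any (λ b → plt b ≡ t) (removed j))

    open? : ∀ t → Dec (Open t)
    open? t = Fin.any? (λ i → any? (λ b → plt b ≟ t) (lookup Q′ i))
        ×-dec Fin.any? (λ j → any? (λ b → plt b ≟ t) (removed j))

    -- Open t entails t ∈ plts, as both witnesses of Open t are bins of the instance,
    -- so filtering plts yields every open pallet.
    openPallets : FinSet ℕ
    openPallets = record
      { elements = filter open? (FinSet.elements plts)
      ; unique   = filter⁺ open? (FinSet.unique plts)
      }

  open Configuration

  Step : Configuration → Configuration → Set
  Step c d = ∃[ i ] ∃₂ λ b q →
    lookup (Q′ c) i ≡ b ∷ q × Q′ d ≡ Q′ c [ i ]≔ q

  record Processing (n : ℕ) : Set where
    field
      config : Fin (suc n) → Configuration
      start  : Q′ (config zero) ≡ Q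
      end    : Q′ (config (fromℕ n)) ≡ replicate k []
      step   : ∀ (i : Fin n) → Step (config (inject₁ i)) (config (suc i))

    openSequence : Vector (FinSet ℕ) (suc n)
    openSequence i = openPallets (config i)

    UsesPlaces : ℕ → Set
    UsesPlaces p = ∀ i → ∣ openSequence i ∣ ≤ p

  SequenceArc : ℕ → ℕ → Set
  SequenceArc u v = u ≢ v × ∃[ i ] ∃₂ λ x y → x Fin.< y
    × plt (List.lookup (lookup Q i) x) ≡ u
    × plt (List.lookup (lookup Q i) y) ≡ v

  private
    plt∈plts : ∀ i x → plt (List.lookup (lookup Q i) x) ∈ plts
    plt∈plts i x = ∈-deduplicate⁺ _≟_
      (∈-map⁺ plt (∈-concat⁺′ (∈-lookup x) (∈-toList⁺ (∈-lookup-Vec i Q))))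

  sequenceGraph : Digraph ℕ
  sequenceGraph = record
    { vertices = plts
    ; Arc      = SequenceArc
    ; Arc⊆V×V  = λ { (_ , i , x , y , _ , refl , refl) → plt∈plts i x , plt∈plts i y }
    }

{-# OPTIONS --safe #-}
module Submission where

-- Call a pallet started once one of its bins has been removed, and pending while one of its
-- bins remains.  Over time "started" is increasing and "pending" is decreasing, and a pallet is
-- open iff it is both: this gives the interval property.  At the step where a pallet becomes
-- started, only one of its at least two bins is removed, so it is still pending: every pallet
-- is open at some time.  For an arc (u , v), right after the first of the two bins has been
-- removed u is started and v is pending; if u is no longer pending, it was open before, and if
-- v is not yet started, it is open later.

open import Defs
open import Data.Nat using (ℕ; zero; suc; _∸_; _⊔_; z≤n; s≤s; s≤s⁻¹; _≟_; _<?_)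
import Data.Nat as ℕ
import Data.Nat.Properties as ℕ
open import Data.Integer using (+_; 1ℤ; _-_; _≤_; -_; +≤+)
import Data.Integer.Properties as ℤ
open import Data.Fin using (Fin; zero; suc; inject₁; fromℕ; toℕ)
import Data.Fin as Fin
import Data.Fin.Properties as Fin
open import Data.List using (List; []; _∷_; _++_; length; map; concat; take; drop; filter)
import Data.List as List
open import Data.List.Properties
  using (filter-++; filter-none; take++drop≡id; take-all; length-++)
open import Data.List.Membership.Propositional.Properties
  using (∈-filter⁺; ∈-filter⁻; ∈-deduplicate⁻)
open import Data.List.Relation.Binary.Pointwise using (Pointwise-≡⇒≡)
open import Data.List.Relation.Binary.Suffix.Heterogeneous using (Suffix; here; there)
open import Data.List.Relation.Binary.Suffix.Heterogeneous.Properties using (length-mono)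
open import Data.List.Relation.Unary.All.Properties using (¬Any⇒All¬)
open import Data.List.Relation.Unary.Any using (Any; here; there; any?)
open import Data.List.Relation.Unary.Any.Properties using (++⁻)
open import Data.Product using (_×_; _,_; proj₁; proj₂; ∃-syntax; ∃₂)
open import Data.Sum using (inj₁; inj₂)
open import Data.Vec using (Vec; []; _∷_; lookup; toList; _[_]≔_)
open import Data.Vec.Functional using (Vector; foldr)
open import Data.Vec.Properties using (lookup-replicate)
open import Function using (_∘_; mk⇔)
open import Level using (0ℓ)
open import Relation.Binary.PropositionalEquality
  using (_≡_; refl; sym; trans; cong; cong₂; subst)
open import Relation.Nullary using (¬_; yes; no; contradiction)
open import Relation.Unary using (Pred; Decidable)

-- Prefixes, suffixes and filtered lists

module _ {A : Set} where

  Any-take-mono : ∀ {P : Pred A 0ℓ} {m n} → m ℕ.≤ n → ∀ xs → Any P (take m xs) → Any P (take n xs)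
  Any-take-mono (s≤s m≤n) (x ∷ xs) (here px) = here px
  Any-take-mono (s≤s m≤n) (x ∷ xs) (there p) = there (Any-take-mono m≤n xs p)

  Any-drop⇒Any : ∀ {P : Pred A 0ℓ} n xs → Any P (drop n xs) → Any P xs
  Any-drop⇒Any zero    xs       p = p
  Any-drop⇒Any (suc n) (x ∷ xs) p = there (Any-drop⇒Any n xs p)

  Any-drop-anti : ∀ {P : Pred A 0ℓ} {m n} → m ℕ.≤ n → ∀ xs → Any P (drop n xs) → Any P (drop m xs)
  Any-drop-anti {n = n} z≤n       xs       p = Any-drop⇒Any n xs p
  Any-drop-anti         (s≤s m≤n) (x ∷ xs) p = Any-drop-anti m≤n xs p

  lookup⇒Any-take : ∀ {P : Pred A 0ℓ} {n} xs i → toℕ i ℕ.< n →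
                    P (List.lookup xs i) → Any P (take n xs)
  lookup⇒Any-take (x ∷ xs) zero    (s≤s _)   px = here px
  lookup⇒Any-take (x ∷ xs) (suc i) (s≤s i<n) px = there (lookup⇒Any-take xs i i<n px)

  lookup⇒Any-drop : ∀ {P : Pred A 0ℓ} {n} xs i → n ℕ.≤ toℕ i →
                    P (List.lookup xs i) → Any P (drop n xs)
  lookup⇒Any-drop (x ∷ xs) zero    z≤n       px = here px
  lookup⇒Any-drop (x ∷ xs) (suc i) z≤n       px = there (lookup⇒Any-drop xs i z≤n px)
  lookup⇒Any-drop (x ∷ xs) (suc i) (s≤s n≤i) px = lookup⇒Any-drop xs i n≤i px

  -- A suffix is determined by its length, so a configuration can be described by how many bins each
  -- sequence has lost.
  Suffix⇒drop : ∀ {xs ys : List A} → Suffix _≡_ xs ys → xs ≡ drop (length ys ∸ length xs) ys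
  Suffix⇒drop {ys = ys} (here eqs) with refl ← Pointwise-≡⇒≡ eqs
    rewrite ℕ.n∸n≡0 (length ys) = refl
  -- Truncated subtraction commutes with the successor only because the suffix is no longer than the
  -- tail; after that `drop` skips the head by computation.
  Suffix⇒drop (there s) rewrite ℕ.+-∸-assoc 1 (length-mono s) = Suffix⇒drop s

  module _ {P : Pred A 0ℓ} (P? : Decidable P) where

    filter-drop : ∀ n xs → ¬ Any P (take n xs) → filter P? (drop n xs) ≡ filter P? xs
    filter-drop n xs ¬p = sym (trans (cong (filter P?) (sym (take++drop≡id n xs)))
      (trans (filter-++ P? (take n xs) (drop n xs))
        (cong (_++ filter P? (drop n xs)) (filter-none P? (¬Any⇒All¬ _ ¬p)))))

    0<length-filter⇒Any : ∀ xs → 0 ℕ.< length (filter P? xs) → Any P xs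
    0<length-filter⇒Any xs 0<l with any? P? xs
    ... | yes p = p
    ... | no ¬p rewrite filter-none P? (¬Any⇒All¬ xs ¬p) = contradiction 0<l λ ()

    length-filter-∷ : ∀ x xs → length (filter P? (x ∷ xs)) ℕ.≤ suc (length (filter P? xs))
    length-filter-∷ x xs with P? x
    ... | yes _ = ℕ.≤-refl
    ... | no  _ = ℕ.n≤1+n _

  -- `flatten Q` unfolds to `bins`, so `twoBins` applies to it directly.
  flatten : ∀ {k} → Vec (List A) k → List A
  flatten = concat ∘ toList

  Any-flatten : ∀ {P : Pred A 0ℓ} {k} (V : Vec (List A) k) →
                Any P (flatten V) → ∃[ i ] Any P (lookup V i)
  Any-flatten (xs ∷ V) p with ++⁻ xs p
  ... | inj₁ q = zero , q
  ... | inj₂ q with i , r ← Any-flatten V q = suc i , r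

  filter-flatten-cong : ∀ {P : Pred A 0ℓ} (P? : Decidable P) {k} (V W : Vec (List A) k) →
    (∀ i → filter P? (lookup V i) ≡ filter P? (lookup W i)) →
    filter P? (flatten V) ≡ filter P? (flatten W)
  filter-flatten-cong P? []       []       eq = refl
  filter-flatten-cong P? (xs ∷ V) (ys ∷ W) eq
    rewrite filter-++ P? xs (flatten V) | filter-++ P? ys (flatten W) =
    cong₂ _++_ (eq zero) (filter-flatten-cong P? V W (eq ∘ suc))

  module _ {b : A} {q : List A} where

    -- Only the head `b` disappears, and it is counted at most once. Hence one of two bins for the
    -- same pallet survives a step.
    length-filter-update : ∀ {P : Pred A 0ℓ} (P? : Decidable P) {k} (V : Vec (List A) k) i →
      lookup V i ≡ b ∷ q →
      length (filter P? (flatten V)) ℕ.≤ suc (length (filter P? (flatten (V [ i ]≔ q))))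
    length-filter-update P? (_  ∷ V) zero    refl = length-filter-∷ P? b (q ++ flatten V)
    length-filter-update P? (xs ∷ V) (suc i) eq
      rewrite filter-++ P? xs (flatten V)
            | filter-++ P? xs (flatten (V [ i ]≔ q))
            | length-++ (filter P? xs) {filter P? (flatten V)}
            | length-++ (filter P? xs) {filter P? (flatten (V [ i ]≔ q))} =
      ℕ.≤-trans (ℕ.+-monoʳ-≤ (length (filter P? xs)) (length-filter-update P? V i eq))
        (ℕ.≤-reflexive (ℕ.+-suc _ _))

    length-update-≤ : ∀ {k} (V : Vec (List A) k) i → lookup V i ≡ b ∷ q →
      ∀ j → length (lookup (V [ i ]≔ q) j) ℕ.≤ length (lookup V j)
    length-update-≤ (_ ∷ V) zero    refl zero    = ℕ.n≤1+n _
    length-update-≤ (_ ∷ V) zero    eq   (suc j) = ℕ.≤-refl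
    length-update-≤ (_ ∷ V) (suc i) eq   zero    = ℕ.≤-refl
    length-update-≤ (_ ∷ V) (suc i) eq   (suc j) = length-update-≤ V i eq j

    length-update-≥ : ∀ {k} (V : Vec (List A) k) i → lookup V i ≡ b ∷ q →
      ∀ j → length (lookup V j) ℕ.≤ suc (length (lookup (V [ i ]≔ q) j))
    length-update-≥ (_ ∷ V) zero    refl zero    = ℕ.≤-refl
    length-update-≥ (_ ∷ V) zero    eq   (suc j) = ℕ.n≤1+n _
    length-update-≥ (_ ∷ V) (suc i) eq   zero    = ℕ.n≤1+n _
    length-update-≥ (_ ∷ V) (suc i) eq   (suc j) = length-update-≥ V i eq j

-- Finite sequences indexed by time

m∸n≤1+[m∸1+n] : ∀ m n → m ∸ n ℕ.≤ suc (m ∸ suc n)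
m∸n≤1+[m∸1+n] m n rewrite sym (ℕ.pred[m∸n]≡m∸[1+n] m n) with m ∸ n
... | zero  = z≤n
... | suc _ = ℕ.≤-refl

-- Finds the step at which a pallet becomes started, and the step that removes a given bin.
first-switch : ∀ {n} {P : Pred (Fin (suc n)) 0ℓ} → Decidable P → ¬ P zero → P (fromℕ n) →
               ∃[ m ] ¬ P (inject₁ m) × P (suc m)
first-switch {zero}  P? ¬p₀ pₙ = contradiction pₙ ¬p₀
first-switch {suc n} P? ¬p₀ pₙ with P? (suc zero)
... | yes p₁ = zero , ¬p₀ , p₁
... | no ¬p₁ with m , ¬p , p ← first-switch (P? ∘ suc) ¬p₁ pₙ = suc m , ¬p , p

steps⇒monotone : ∀ {n} (f : Fin (suc n) → ℕ) → (∀ m → f (inject₁ m) ℕ.≤ f (suc m)) →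
                 ∀ {i j} → i Fin.≤ j → f i ℕ.≤ f j
steps⇒monotone         f s {zero}  {zero}  _         = ℕ.≤-refl
steps⇒monotone {suc n} f s {zero}  {suc j} _         =
  ℕ.≤-trans (s zero) (steps⇒monotone (f ∘ suc) (s ∘ suc) {zero} {j} z≤n)
steps⇒monotone {suc n} f s {suc i} {suc j} (s≤s i≤j) = steps⇒monotone (f ∘ suc) (s ∘ suc) i≤j

foldr-⊔-lub : ∀ {r} (f : Vector ℕ r) {p} → (∀ i → f i ℕ.≤ p) → foldr _⊔_ 0 f ℕ.≤ p
foldr-⊔-lub {zero}  f f≤p = z≤n
foldr-⊔-lub {suc r} f f≤p = ℕ.⊔-lub (f≤p zero) (foldr-⊔-lub (f ∘ suc) (f≤p ∘ suc))

-- Pallets and positions during a processing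

module _ (I : Instance) {n : ℕ} (P : Processing I n) where
  open Instance I
  open Processing P
  open Configuration

  -- Counts the bins already removed from a sequence, so that `removed` is by definition the `take`
  -- of this length.
  position : Fin (suc n) → Fin k → ℕ
  position m i = length (lookup Q i) ∸ length (lookup (Q′ (config m)) i)

  Destined : ℕ → Pred Bin 0ℓ
  Destined t b = plt b ≡ t

  -- The two factors of `Open`, separated because each is monotone in time while their conjunction
  -- is not.
  Pending Started : ℕ → Fin (suc n) → Set
  Pending t m = ∃[ i ] Any (Destined t) (lookup (Q′ (config m)) i)
  Started t m = ∃[ j ] Any (Destined t) (removed (config m) j)

  destined? : ∀ t → Decidable (Destined t)
  destined? t b = plt b ≟ t

  pending? : ∀ t → Decidable (Pending t)
  pending? t m = Fin.any? (λ i → any? (destined? t) _)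

  started? : ∀ t → Decidable (Started t)
  started? t m = Fin.any? (λ j → any? (destined? t) _)

  remaining≡drop : ∀ m i → lookup (Q′ (config m)) i ≡ drop (position m i) (lookup Q i)
  remaining≡drop m i = Suffix⇒drop (suffix (config m) i)

  position-mono : ∀ {l m} → l Fin.≤ m → ∀ i → position l i ℕ.≤ position m i
  position-mono l≤m i = steps⇒monotone (λ m → position m i) position-step l≤m
    where
    position-step : ∀ m → position (inject₁ m) i ℕ.≤ position (suc m) i
    position-step m with j , _ , _ , eq , eq′ ← step m rewrite eq′ =
      ℕ.∸-monoʳ-≤ (length (lookup Q i)) (length-update-≤ (Q′ (config (inject₁ m))) j eq i)

  -- A step shortens each sequence by at most one bin, so no position can skip over a bin.
  position-suc : ∀ m i → position (suc m) i ℕ.≤ suc (position (inject₁ m) i)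
  position-suc m i with j , _ , _ , eq , eq′ ← step m rewrite eq′ =
    ℕ.≤-trans (m∸n≤1+[m∸1+n] (length (lookup Q i)) _)
      (s≤s (ℕ.∸-monoʳ-≤ (length (lookup Q i)) (length-update-≥ (Q′ (config (inject₁ m))) j eq i)))

  position-start : ∀ i → position zero i ≡ 0
  position-start i rewrite start = ℕ.n∸n≡0 (length (lookup Q i))

  position-end : ∀ i → position (fromℕ n) i ≡ length (lookup Q i)
  position-end i rewrite end | lookup-replicate {A = List Bin} i [] = refl

  Started-mono : ∀ {t l m} → l Fin.≤ m → Started t l → Started t m
  Started-mono l≤m (j , s) = j , Any-take-mono (position-mono l≤m j) (lookup Q j) s

  Pending-anti : ∀ {t l m} → l Fin.≤ m → Pending t m → Pending t l
  Pending-anti {t} {l} {m} l≤m (i , p) = i , subst (Any (Destined t)) (sym (remaining≡drop l i))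
    (Any-drop-anti (position-mono l≤m i) (lookup Q i)
      (subst (Any (Destined t)) (remaining≡drop m i) p))

  ∈-open⁺ : ∀ {t m} → t ∈ plts → Pending t m → Started t m → t ∈ openSequence m
  ∈-open⁺ {m = m} t∈ p s = ∈-filter⁺ (open? (config m)) t∈ (p , s)

  ∈-open⁻ : ∀ {t m} → t ∈ openSequence m → t ∈ plts × Pending t m × Started t m
  ∈-open⁻ {m = m} = ∈-filter⁻ (open? (config m))

  -- Every pallet is open at some time

  ¬Started-start : ∀ {t} → ¬ Started t zero
  ¬Started-start (j , s) rewrite position-start j = contradiction s λ ()

  started-end : ∀ {t} → t ∈ plts → Started t (fromℕ n)
  started-end {t} t∈
    with i , p ← Any-flatten Q (0<length-filter⇒Any (destined? t) bins
      (ℕ.<⇒≤ (twoBins (∈-deduplicate⁻ _≟_ (map plt bins) t∈))))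
    = i , subst (Any (Destined t)) (sym (take-all _ (lookup Q i)
            (ℕ.≤-reflexive (sym (position-end i))))) p

  -- Before the step all bins for `t`, at least two, still remain, and the step takes at most one of
  -- them.
  pending-after-start : ∀ {t} → t ∈ plts → ∀ m → ¬ Started t (inject₁ m) → Pending t (suc m)
  pending-after-start {t} t∈ m ¬s
    with i , _ , q , eq , eq′ ← step m rewrite eq′ =
    -- Cancelling a successor in `2 ≤ suc c`, where `c` counts the bins for `t` left after the step,
    -- gives `0 < c`.
    Any-flatten (V [ i ]≔ q) (0<length-filter⇒Any (destined? t) _ (s≤s⁻¹ (begin
      2                                           ≤⟨ twoBins (∈-deduplicate⁻ _≟_ (map plt bins) t∈) ⟩
      length (filter (destined? t) (flatten Q))   ≡⟨ cong length (filter-flatten-cong (destined? t) Q V none-removed) ⟩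
      length (filter (destined? t) (flatten V))   ≤⟨ length-filter-update (destined? t) V i eq ⟩
      suc (length (filter (destined? t) (flatten (V [ i ]≔ q)))) ∎)))
    where
    open ℕ.≤-Reasoning
    V = Q′ (config (inject₁ m))
    none-removed : ∀ j → filter (destined? t) (lookup Q j) ≡ filter (destined? t) (lookup V j)
    none-removed j = trans
      (sym (filter-drop (destined? t) (position (inject₁ m) j) (lookup Q j) λ s → ¬s (j , s)))
      (cong (filter (destined? t)) (sym (remaining≡drop (inject₁ m) j)))

  sometime-open : ∀ {t} → t ∈ plts → ∃[ m ] t ∈ openSequence m
  sometime-open {t} t∈ with m , ¬s , s ← first-switch (started? t) ¬Started-start (started-end t∈)
    = suc m , ∈-open⁺ t∈ (pending-after-start t∈ m ¬s) s

  -- If `t` is not pending at `m`, it cannot be open at `m` or later, as being pending would pass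
  -- back to `m`.
  open-before : ∀ {t m} → t ∈ plts → Started t m → ∃[ l ] l Fin.≤ m × t ∈ openSequence l
  open-before {t} {m} t∈ s with pending? t m | sometime-open t∈
  ... | yes p | _      = m , ℕ.≤-refl , ∈-open⁺ t∈ p s
  ... | no ¬p | l , t∈l with Fin.≤-total l m
  ...   | inj₁ l≤m = l , l≤m , t∈l
  ...   | inj₂ m≤l = contradiction (Pending-anti m≤l (proj₁ (proj₂ (∈-open⁻ t∈l)))) ¬p

  -- Dually, if `t` is not started at `m`, an open time at or before `m` would make it started at
  -- `m`.
  open-after : ∀ {t m} → t ∈ plts → Pending t m → ∃[ l ] m Fin.≤ l × t ∈ openSequence l
  open-after {t} {m} t∈ p with started? t m | sometime-open t∈
  ... | yes s | _      = m , ℕ.≤-refl , ∈-open⁺ t∈ p s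
  ... | no ¬s | l , t∈l with Fin.≤-total l m
  ...   | inj₁ l≤m = contradiction (Started-mono l≤m (proj₂ (proj₂ (∈-open⁻ t∈l)))) ¬s
  ...   | inj₂ m≤l = l , m≤l , t∈l

  -- The time is right after the removal of the bin at `x`; the bin at `y`, behind it in the same
  -- sequence, is then still there.
  arc-witness : ∀ {u v} → SequenceArc I u v → ∃[ m ] Started u m × Pending v m
  arc-witness {u} {v} (_ , i , x , y , x<y , x↦u , y↦v)
    with m , ¬x<pos , x<pos ← first-switch (λ m → toℕ x <? position m i)
      (λ x<0 → contradiction (subst (toℕ x ℕ.<_) (position-start i) x<0) λ ())
      (subst (toℕ x ℕ.<_) (sym (position-end i)) (Fin.toℕ<n x))
    = suc m , (i , lookup⇒Any-take (lookup Q i) x x<pos x↦u)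
            , (i , subst (Any (Destined v)) (sym (remaining≡drop (suc m) i))
                     (lookup⇒Any-drop (lookup Q i) y pos≤y y↦v))
    where
    -- The new position is at most one more than the old one, which is at most `x`; and `x<y` reads
    -- `suc x ≤ y`.
    pos≤y = ℕ.≤-trans (position-suc m i) (ℕ.≤-trans (s≤s (ℕ.≮⇒≥ ¬x<pos)) x<y)

  -- The decomposition and its width

  openSequence-isDirectedPathDecomposition :
    IsDirectedPathDecomposition (sequenceGraph I) openSequence
  openSequence-isDirectedPathDecomposition = record
    { union    = mk⇔ (λ { (m , t∈m) → proj₁ (∈-open⁻ {m = m} t∈m) }) sometime-open
    ; arcs     = arcs
    -- Pending is carried back from `j`, started is carried forward from `i`.
    ; interval = λ _ u∈i u∈j l i≤l l≤j → ∈-open⁺ (proj₁ (∈-open⁻ u∈i))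
        (Pending-anti l≤j (proj₁ (proj₂ (∈-open⁻ u∈j))))
        (Started-mono i≤l (proj₂ (proj₂ (∈-open⁻ u∈i))))
    }
    where
    arcs : ∀ {u v} → SequenceArc I u v →
           ∃₂ λ i j → i Fin.≤ j × u ∈ openSequence i × v ∈ openSequence j
    arcs a with m , s , p ← arc-witness a
              | u∈ , v∈ ← Digraph.Arc⊆V×V (sequenceGraph I) a
      with i , i≤m , u∈i ← open-before u∈ s
         | j , m≤j , v∈j ← open-after v∈ p
      = i , j , ℕ.≤-trans i≤m m≤j , u∈i , v∈j

theorem1 : (I : Instance) (P : Processing I (length (Instance.bins I))) (p : ℕ) →
    Processing.UsesPlaces P p →
    IsDirectedPathDecomposition (sequenceGraph I) (Processing.openSequence P)
    × width (Processing.openSequence P) ≤ + p - 1ℤ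
theorem1 I P p uses = openSequence-isDirectedPathDecomposition I P
  -- The largest bag has at most `p` elements; this bound is moved to the integers and 1 is
  -- subtracted on both sides.
  , ℤ.+-monoˡ-≤ (- 1ℤ) (+≤+ (foldr-⊔-lub (λ i → ∣ Processing.openSequence P i ∣) uses))
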